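{- There is no deterministic online algorithm for dynamic queues with competitive ratio smaller than $1.6329$; this holds even in the decremental case.
   Context: Dynamic set problem: each item $x$ has a weight $w_x\ge 0$; time proceeds in steps; before each step items may be inserted into or deleted from a dynamic set $\mathcal{S}$; an item is active if inserted and not yet deleted; at each step an algorithm may collect at most one active item it has not collected before (pending items); the gain is the total weight collected. Online algorithms decide knowing only past insertions/deletions. A deterministic online algorithm is $R$-competitive if on every instance its gain is at least $\mathrm{OPT}/R$ ($\mathrm{OPT}$ = maximum achievable gain); the competitive ratio is the infimum of such $R$. Dynamic queue: $\mathcal{S}$ is a linearly ordered list; items may be inserted at any position, but only a prefix of the current list may be deleted. Decremental: all items are inserted before the first step, afterwards only deletions occur. -}

module Defs where

open import Data.Nat using (ℕ; zero; suc; _+_; _≤_; _≤?_)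
open import Data.Fin using (Fin; toℕ; _≟_)
open import Data.List using (List; []; _∷_; map; zip)
open import Data.List.Relation.Unary.Any using (any?)
open import Data.Product using (_×_; _,_)
open import Data.Maybe using (Maybe; just; nothing)
open import Data.Integer using (+_)
open import Data.Rational using (ℚ; _/_; _*_) renaming (_≤_ to _≤ℚ_)
open import Relation.Nullary using (¬_; yes; no)

-- A decremental dynamic-queue instance.
-- The n items are listed in queue order as Fin n (index 0 = front of the list);
-- all are inserted before the first step. Weights are natural numbers
-- (by scaling this is no loss for a lower bound).
-- The instance runs for T steps; before step t (t = 1..T) a prefix is deleted,
-- so that in total the first d_t items of the original list are deleted.
-- `dels` = [d_1, ..., d_T], nondecreasing, each ≤ n.
data Sorted : List ℕ → Set where
  []  : Sorted []
  [-] : ∀ {x} → Sorted (x ∷ [])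
  _∷_ : ∀ {x y ys} → x ≤ y → Sorted (y ∷ ys) → Sorted (x ∷ y ∷ ys)

data AllLe (n : ℕ) : List ℕ → Set where
  []  : AllLe n []
  _∷_ : ∀ {x xs} → x ≤ n → AllLe n xs → AllLe n (x ∷ xs)

record Instance : Set where
  field
    n      : ℕ
    w      : Fin n → ℕ
    dels   : List ℕ
    sorted : Sorted dels
    bound  : AllLe n dels

-- A deterministic online algorithm: at step t it sees the initial list
-- (n and weights) and the deletion history d_1..d_t (all deletions that
-- happened before step t), and picks an item to collect (or nothing).
-- Its earlier picks are a function of this same information.
OnlineAlg : Set
OnlineAlg = (n : ℕ) → (Fin n → ℕ) → List ℕ → Maybe (Fin n)

histories : List ℕ → List (List ℕ)
histories []       = []
histories (d ∷ ds) = (d ∷ []) ∷ map (d ∷_) (histories ds)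

run : {n : ℕ} → (Fin n → ℕ) → List (Fin n) → List (ℕ × Maybe (Fin n)) → ℕ
run w col [] = 0
run w col ((d , nothing) ∷ rest) = run w col rest
run w col ((d , just i) ∷ rest) with d ≤? toℕ i | any? (i ≟_) col
... | yes _ | no _ = w i + run w (i ∷ col) rest
... | _     | _    = run w col rest

algGain : OnlineAlg → Instance → ℕ
algGain A I = run w [] (zip dels (map (A n w) (histories dels)))
  where open Instance I

schedGain : (I : Instance) → List (Maybe (Fin (Instance.n I))) → ℕ
schedGain I s = run w [] (zip dels s)
  where open Instance I

ℕtoℚ : ℕ → ℚ
ℕtoℚ k = (+ k) / 1

-- A is R-competitive (on decremental dynamic queues): on every instance,
-- gain ≥ OPT / R, i.e. OPT ≤ R * gain, where OPT is the maximum gain over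
-- all schedules (so: every schedule's gain is ≤ R * gain).
Competitive : OnlineAlg → ℚ → Set
Competitive A R = (I : Instance) (s : List (Maybe (Fin (Instance.n I)))) →
  ℕtoℚ (schedGain I s) ≤ℚ R * ℕtoℚ (algGain A I)

-- Against six items a₁ a₂ a₃ b₃ b₂ b₁ (in queue order) a small game tree suffices.
-- If the algorithm starts with the heaviest item b₁, the adversary deletes all the
-- others, having collected b₂ first, and gets b₁ later.  If it starts with one of the
-- light items a₁, a₂, a₃, b₃, the adversary collects b₁ and stops.  If it starts with
-- b₂, the adversary deletes a₁: a further light pick is again punished by stopping,
-- while each pick of a b lets the adversary collect items about to be deleted and take
-- the picked ones later, once everything else is gone.
{-# OPTIONS --safe #-}
module Submission where

open import Defs
open import Data.Bool using (if_then_else_)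
open import Data.Fin using (Fin; toℕ; #_)
import Data.Fin.Properties as Fin
open import Data.Integer using (+_)
import Data.Integer as ℤ
import Data.Integer.Properties as ℤ
open import Data.List using (List; []; _∷_; _++_; [_]; map; zip)
import Data.List.Properties as List
open import Data.List.Membership.Propositional using (_∈_; _∉_)
open import Data.List.Membership.Propositional.Properties using (∈-∃++)
open import Data.List.Relation.Binary.Permutation.Propositional.Properties using (shift; map⁺; ∈-resp-↭)
open import Data.List.Relation.Binary.Subset.Propositional using (_⊆_)
import Data.List.Relation.Unary.All as All
open import Data.List.Relation.Unary.All.Properties using (¬Any⇒All¬)
open import Data.List.Relation.Unary.AllPairs using ([]; _∷_)
open import Data.List.Relation.Unary.Any using (here; there; any?)
open import Data.List.Relation.Unary.Unique.Propositional using (Unique)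
open import Data.Maybe using (Maybe; just; nothing)
open import Data.Nat using (ℕ; suc; _+_; _*_; _≤_; _≤?_; _<?_; z≤n)
import Data.Nat as ℕ
import Data.Nat.Properties as ℕ
open import Data.Nat.ListAction using (sum)
open import Data.Nat.ListAction.Properties using (sum-↭)
open import Data.Product using (∃-syntax; _×_; _,_)
open import Data.Rational using (ℚ; _/_; _<_; toℚᵘ)
import Data.Rational as ℚ
import Data.Rational.Properties as ℚ
open import Data.Rational.Unnormalised using (mkℚᵘ; *≤*)
import Data.Rational.Unnormalised as ℚᵘ
import Data.Rational.Unnormalised.Properties as ℚᵘ
open import Data.Vec using ([]; _∷_; lookup)
open import Relation.Binary.PropositionalEquality using (_≡_; refl; sym; trans; cong; subst; subst₂)
open import Relation.Nullary using (¬_; Dec; yes; no; does; contradiction; from-yes; _×-dec_; _→-dec_; map′)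
open import Function using (id; _∘_)

sorted? : ∀ xs → Dec (Sorted xs)
sorted? []           = yes []
sorted? (x ∷ [])     = yes [-]
sorted? (x ∷ y ∷ ys) =
  map′ (λ (p , q) → p ∷ q) (λ { (p ∷ q) → p , q }) (x ≤? y ×-dec sorted? (y ∷ ys))

allLe? : ∀ n xs → Dec (AllLe n xs)
allLe? n []       = yes []
allLe? n (x ∷ xs) = map′ (λ (p , q) → p ∷ q) (λ { (p ∷ q) → p , q }) (x ≤? n ×-dec allLe? n xs)

-- Clearing denominators turns competitiveness into an inequality of natural numbers, the form that
-- the leaves of the game tree decide. Unnormalised rationals avoid reduction by the gcd.
competitive⇒≤ : ∀ p q R s g → R < (+ p) / suc q → ℕtoℚ s ℚ.≤ R ℚ.* ℕtoℚ g → suc q * s ≤ p * g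
competitive⇒≤ p q R s g R<p/q s≤Rg = ℤ.drop‿+≤+ (subst₂ ℤ._≤_ lhs rhs (ℚᵘ.drop-*≤* s≤pg/q))
  where
  instance
    g≥0 : ℚ.NonNegative (ℕtoℚ g)
    g≥0 = ℚ.normalize-nonNeg g 1

  s≤pg/q : mkℚᵘ (+ s) 0 ℚᵘ.≤ mkℚᵘ (+ p) q ℚᵘ.* mkℚᵘ (+ g) 0
  s≤pg/q = begin
    mkℚᵘ (+ s) 0                            ≃⟨ ℚ.toℚᵘ-fromℚᵘ (mkℚᵘ (+ s) 0) ⟨
    toℚᵘ (ℕtoℚ s)                           ≤⟨ ℚ.toℚᵘ-mono-≤ s≤Rg ⟩
    toℚᵘ (R ℚ.* ℕtoℚ g)                     ≤⟨ ℚ.toℚᵘ-mono-≤ (ℚ.*-monoʳ-≤-nonNeg (ℕtoℚ g) (ℚ.<⇒≤ R<p/q)) ⟩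
    toℚᵘ ((+ p) / suc q ℚ.* ℕtoℚ g)         ≃⟨ ℚ.toℚᵘ-homo-* ((+ p) / suc q) (ℕtoℚ g) ⟩
    toℚᵘ ((+ p) / suc q) ℚᵘ.* toℚᵘ (ℕtoℚ g) ≃⟨ ℚᵘ.*-cong (ℚ.toℚᵘ-fromℚᵘ (mkℚᵘ (+ p) q)) (ℚ.toℚᵘ-fromℚᵘ (mkℚᵘ (+ g) 0)) ⟩
    mkℚᵘ (+ p) q ℚᵘ.* mkℚᵘ (+ g) 0          ∎
    where open ℚᵘ.≤-Reasoning

  lhs : (+ s) ℤ.* (+ (suc q * 1)) ≡ + (suc q * s)
  lhs = trans (sym (ℤ.pos-* s (suc q * 1)))
    (cong +_ (trans (cong (s *_) (ℕ.*-identityʳ (suc q))) (ℕ.*-comm s (suc q))))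

  rhs : (+ p) ℤ.* (+ g) ℤ.* (+ 1) ≡ + (p * g)
  rhs = trans (ℤ.*-identityʳ _) (sym (ℤ.pos-* p g))

-- The adversary's own schedule is fixed only at a leaf, in hindsight. `Responses` is nonempty, so a
-- wasted step always has a branch to follow.
data Strategy (n : ℕ) : Set
data Responses (n : ℕ) : Set

data Strategy n where
  stop-with : List (Maybe (Fin n)) → Strategy n
  delete_⟨_⟩ : ℕ → Responses n → Strategy n

infixr 5 _↦_ _↦_∣_

data Responses n where
  _↦_   : Fin n → Strategy n → Responses n
  _↦_∣_ : Fin n → Strategy n → Responses n → Responses n

answered : ∀ {n} → Responses n → List (Fin n)
answered (i ↦ σ)      = [ i ]
answered (i ↦ σ ∣ rs) = i ∷ answered rs

first : ∀ {n} → Responses n → Fin n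
first (i ↦ _)     = i
first (i ↦ _ ∣ _) = i

first-answered : ∀ {n xs} (rs : Responses n) → first rs ∈ answered rs ++ xs
first-answered (_ ↦ _)     = here refl
first-answered (_ ↦ _ ∣ _) = here refl

-- Duplicates are dropped so that a branch naming the same item again does not raise the bound on
-- the algorithm's gain.
insert : ∀ {n} → Fin n → List (Fin n) → List (Fin n)
insert i xs = if does (any? (i Fin.≟_) xs) then xs else i ∷ xs

∈-insert : ∀ {n} (i : Fin n) xs → i ∈ insert i xs
∈-insert i xs with any? (i Fin.≟_) xs
... | yes i∈xs = i∈xs
... | no  _    = here refl

⊆-insert : ∀ {n} (i : Fin n) xs → xs ⊆ insert i xs
⊆-insert i xs x∈xs with any? (i Fin.≟_) xs
... | yes _ = x∈xs
... | no  _ = there x∈xs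

module Game {n : ℕ} (w : Fin n → ℕ) (p q : ℕ) where

  weight : List (Fin n) → ℕ
  weight xs = sum (map w xs)

  -- A permutation brings the head of `xs` to the front of `ys`, where it cancels; by uniqueness the
  -- tail of `xs` lies in what is left.
  weight-mono : ∀ {xs ys} → Unique xs → xs ⊆ ys → weight xs ≤ weight ys
  weight-mono {[]}     []         _     = z≤n
  weight-mono {x ∷ xs} (x∉xs ∷ u) xs⊆ys with ∈-∃++ (xs⊆ys (here refl))
  ... | as , bs , refl = ℕ.≤-trans
    (ℕ.+-monoʳ-≤ (w x) (weight-mono u rest⊆))
    (ℕ.≤-reflexive (sym (sum-↭ (map⁺ w (shift x as bs)))))
    where
    rest⊆ : xs ⊆ as ++ bs
    rest⊆ z∈xs with ∈-resp-↭ (shift x as bs) (xs⊆ys (there z∈xs))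
    ... | here refl = contradiction refl (All.lookup x∉xs z∈xs)
    ... | there z∈  = z∈

  -- The equations hold for every `rest` because later deletions are chosen only after the pick is
  -- classified.
  data Step (col : List (Fin n)) (d : ℕ) (m : Maybe (Fin n)) : Set where
    wasted : (∀ rest → run w col ((d , m) ∷ rest) ≡ run w col rest) → Step col d m
    gained : ∀ i → d ≤ toℕ i → i ∉ col →
             (∀ rest → run w col ((d , m) ∷ rest) ≡ w i + run w (i ∷ col) rest) → Step col d m

  step : ∀ col d m → Step col d m
  step col d nothing  = wasted (λ _ → refl)
  step col d (just i) with d ≤? toℕ i in eq | any? (i Fin.≟_) col in eq′
  ... | yes d≤i | no i∉col = gained i d≤i i∉col eqn
    where
    eqn : ∀ rest → run w col ((d , just i) ∷ rest) ≡ w i + run w (i ∷ col) rest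
    eqn rest rewrite eq | eq′ = refl
  ... | yes d≤i | yes i∈col = wasted eqn
    where
    eqn : ∀ rest → run w col ((d , just i) ∷ rest) ≡ run w col rest
    eqn rest rewrite eq | eq′ = refl
  ... | no d≰i | _ = wasted eqn
    where
    eqn : ∀ rest → run w col ((d , just i) ∷ rest) ≡ run w col rest
    eqn rest rewrite eq = refl

  record Beaten (dels : List ℕ) (seen : List (Fin n)) (sched : List (Maybe (Fin n))) : Set where
    constructor beaten
    field
      sorted : Sorted dels
      bound  : AllLe n dels
      gap    : p * weight seen ℕ.< q * run w [] (zip dels sched)

  beaten? : ∀ dels seen sched → Dec (Beaten dels seen sched)
  beaten? dels seen sched =
    map′ (λ (s , b , g) → beaten s b g) (λ (beaten s b g) → s , b , g)
      (sorted? dels ×-dec allLe? n dels ×-dec (_ <? _))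

  -- `seen` contains everything the algorithm has collected and possibly more: a useless
  -- pick is answered as if some useful item had been picked, which only overestimates
  -- the algorithm's gain.  `past` prepends the deletions made so far.
  Wins    : Strategy n → (List ℕ → List ℕ) → List (Fin n) → Set
  WinsAll : Responses n → (List ℕ → List ℕ) → List (Fin n) → Set
  Wins (stop-with s)    past seen = Beaten (past []) seen s
  Wins (delete d ⟨ rs ⟩) past seen =
    (∀ i → d ≤ toℕ i → i ∈ answered rs ++ seen) × WinsAll rs (past ∘ (d ∷_)) seen
  WinsAll (i ↦ σ)      past seen = Wins σ past (insert i seen)
  WinsAll (i ↦ σ ∣ rs) past seen = Wins σ past (insert i seen) × WinsAll rs past seen

  wins?    : ∀ σ past seen → Dec (Wins σ past seen)
  winsAll? : ∀ rs past seen → Dec (WinsAll rs past seen)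
  wins? (stop-with s)     past seen = beaten? (past []) seen s
  wins? (delete d ⟨ rs ⟩) past seen =
    Fin.all? (λ i → (d ≤? toℕ i) →-dec any? (i Fin.≟_) (answered rs ++ seen))
    ×-dec winsAll? rs (past ∘ (d ∷_)) seen
  winsAll? (i ↦ σ)      past seen = wins? σ past (insert i seen)
  winsAll? (i ↦ σ ∣ rs) past seen = wins? σ past (insert i seen) ×-dec winsAll? rs past seen

  gain : (List ℕ → Maybe (Fin n)) → List (Fin n) → List ℕ → ℕ
  gain B col dels = run w col (zip dels (map B (histories dels)))

  -- Here `B` has already been fed the past deletions, and `dels` holds only those to come. Future
  -- gain plus weight already collected is bounded by the leaf's `seen`.
  Refutation : (List ℕ → List ℕ) → (List ℕ → Maybe (Fin n)) → List (Fin n) → Set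
  Refutation past B col =
    ∃[ dels ] ∃[ seen ] ∃[ sched ]
      gain B col dels + weight col ≤ weight seen × Beaten (past dels) seen sched

  -- What remains after a step is again a game, against the algorithm with `d` prefixed to every
  -- history; fusing two maps over `histories` identifies the picks.
  after-wasted : ∀ {past B col} d →
    (∀ rest → run w col ((d , B [ d ]) ∷ rest) ≡ run w col rest) →
    Refutation (past ∘ (d ∷_)) (B ∘ (d ∷_)) col → Refutation past B col
  after-wasted {B = B} {col} d eqn (dels , seen , sched , le , b) =
    d ∷ dels , seen , sched , subst (λ g → g + weight col ≤ weight seen) (sym eq) le , b
    where
    eq : gain B col (d ∷ dels) ≡ gain (B ∘ (d ∷_)) col dels
    eq = trans (eqn _) (cong (run w col ∘ zip dels) (sym (List.map-∘ (histories dels))))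

  after-gained : ∀ {past B col} d i →
    (∀ rest → run w col ((d , B [ d ]) ∷ rest) ≡ w i + run w (i ∷ col) rest) →
    Refutation (past ∘ (d ∷_)) (B ∘ (d ∷_)) (i ∷ col) → Refutation past B col
  after-gained {B = B} {col} d i eqn (dels , seen , sched , le , b) =
    d ∷ dels , seen , sched , subst (_≤ weight seen) (sym eq) le , b
    where
    open Relation.Binary.PropositionalEquality.≡-Reasoning
    g = gain (B ∘ (d ∷_)) (i ∷ col) dels
    eq : gain B col (d ∷ dels) + weight col ≡ g + weight (i ∷ col)
    eq = begin
      gain B col (d ∷ dels) + weight col ≡⟨ cong (_+ weight col) (eqn _) ⟩
      _                                  ≡⟨ cong (λ ms → w i + run w (i ∷ col) (zip dels ms) + weight col)
                                                 (List.map-∘ (histories dels)) ⟨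
      w i + g + weight col               ≡⟨ cong (_+ weight col) (ℕ.+-comm (w i) g) ⟩
      g + w i + weight col               ≡⟨ ℕ.+-assoc g (w i) (weight col) ⟩
      g + weight (i ∷ col)               ∎

  play : ∀ σ {past seen} → Wins σ past seen →
         ∀ B {col} → Unique col → col ⊆ seen → Refutation past B col
  respond : ∀ rs {past seen} → WinsAll rs past seen →
            ∀ B {col} → Unique col → ∀ i → i ∈ answered rs ++ seen → col ⊆ i ∷ seen →
            Refutation past B col

  play (stop-with s) {seen = seen} b B u col⊆ = [] , seen , s , weight-mono u col⊆ , b
  play (delete d ⟨ rs ⟩) {seen = seen} (answers , wins) B {col} u col⊆ with step col d (B [ d ])
  ... | wasted eqn =
    after-wasted d eqn (respond rs wins _ u (first rs) (first-answered rs) (there ∘ col⊆))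
  ... | gained i d≤i i∉col eqn =
    after-gained d i eqn
      (respond rs wins _ (¬Any⇒All¬ col i∉col ∷ u) i (answers i d≤i)
        λ { (here refl) → here refl ; (there x∈) → there (col⊆ x∈) })

  respond (j ↦ σ) {seen = seen} win B u i i∈ col⊆ =
    play σ win B u (λ x∈ → inserted i∈ (col⊆ x∈))
    where
    inserted : ∀ {x} → i ∈ j ∷ seen → x ∈ i ∷ seen → x ∈ insert j seen
    inserted _              (there x∈)  = ⊆-insert j seen x∈
    inserted (here refl)    (here refl) = ∈-insert j seen
    -- An item already credited in `seen`, though perhaps collected only now, falls through to the
    -- last branch and adds nothing to the bound.
    inserted (there i∈seen) (here refl) = ⊆-insert j seen i∈seen
  respond (j ↦ σ ∣ rs) {seen = seen} (win , wins) B u i (here refl) col⊆ =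
    play σ win B u λ x∈ → inserted (col⊆ x∈)
    where
    inserted : ∀ {x} → x ∈ j ∷ seen → x ∈ insert j seen
    inserted (here refl) = ∈-insert j seen
    inserted (there x∈)  = ⊆-insert j seen x∈
  respond (j ↦ σ ∣ rs) (win , wins) B u i (there i∈) col⊆ = respond rs wins B u i i∈ col⊆

-- The weights balance the leaves of the game tree: they round, up to scaling, a
-- numerical optimum for these six items, of value about 1.63297.
weights : Fin 6 → ℕ
weights = lookup (804 ∷ 482 ∷ 421 ∷ 553 ∷ 831 ∷ 1313 ∷ [])

adversary : Strategy 6
adversary = delete 0 ⟨
    a₁ ↦ stop-with (just b₁ ∷ [])
  ∣ a₂ ↦ stop-with (just b₁ ∷ [])
  ∣ a₃ ↦ stop-with (just b₁ ∷ [])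
  ∣ b₃ ↦ stop-with (just b₁ ∷ [])
  ∣ b₂ ↦ delete 1 ⟨
        a₂ ↦ stop-with (just b₂ ∷ just b₁ ∷ [])
      ∣ a₃ ↦ stop-with (just b₂ ∷ just b₁ ∷ [])
      ∣ b₃ ↦ delete 2 ⟨
            a₃ ↦ stop-with (just a₁ ∷ just b₂ ∷ just b₁ ∷ [])
          -- Every surviving item is now in `seen`, so the repeated `b₁` branches leave it
          -- unchanged; they only give the adversary time to collect the survivors.
          ∣ b₁ ↦ delete 3 ⟨ b₁ ↦ delete 3 ⟨ b₁ ↦ delete 3 ⟨ b₁ ↦
                   stop-with (just a₁ ∷ just a₂ ∷ just a₃ ∷ just b₃ ∷ just b₂ ∷ just b₁ ∷ []) ⟩ ⟩ ⟩
          ⟩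
      ∣ b₁ ↦ delete 4 ⟨ b₁ ↦ delete 4 ⟨ b₁ ↦
               stop-with (just a₁ ∷ just b₃ ∷ just b₂ ∷ just b₁ ∷ []) ⟩ ⟩
      ⟩
  ∣ b₁ ↦ delete 5 ⟨ b₁ ↦ stop-with (just b₂ ∷ just b₁ ∷ []) ⟩
  ⟩
  where
  a₁ a₂ a₃ b₃ b₂ b₁ : Fin 6
  a₁ = # 0
  a₂ = # 1
  a₃ = # 2
  b₃ = # 3
  b₂ = # 4
  b₁ = # 5

open Game weights 16329 10000

theorem3 : (A : OnlineAlg) (R : ℚ) → R < (+ 16329) / 10000 → ¬ Competitive A R
theorem3 A R R< comp
  -- Evaluating `wins?` checks the whole tree: legality of deletions, coverage of all picks, and the
  -- gap at each leaf.
  with play adversary (from-yes (wins? adversary id [])) (A 6 weights) [] id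
... | dels , seen , sched , gain≤ , beaten sorted bound gap =
  ℕ.<⇒≱ gap (ℕ.≤-trans (competitive⇒≤ 16329 9999 R (schedGain I sched) (algGain A I) R< (comp I sched)) (ℕ.*-monoʳ-≤ 16329 algGain≤))
  where
  I : Instance
  I = record { n = 6 ; w = weights ; dels = dels ; sorted = sorted ; bound = bound }

  algGain≤ : algGain A I ≤ weight seen
  algGain≤ = ℕ.≤-trans (ℕ.m≤m+n _ 0) gain≤
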